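{- Every finite set $\mathcal{S}$ of logical relations such that all relations in $\mathcal{S}$ are safely componentwise bijunctive, or all are safely componentwise IHSB$-$, or all are safely componentwise IHSB$+$, or all are affine, is constraint-projection separating.
   Context: A logical relation of arity $n$ is a subset of $\{0,1\}^n$. A $\mathrm{CNF}_C(\mathcal{S})$-formula is a finite conjunction of constraints $R(\xi_1,\dots,\xi_k)$ with $R\in\mathcal{S}$ and each $\xi_j$ a variable or a constant $0,1$. The solution graph $G(\phi)$ has the satisfying assignments as vertices, adjacent iff they differ in exactly one variable; $G(R)$ is defined likewise for a relation. For a constraint $C_i$ of $\phi$, $\mathrm{Var}(C_i)$ is the set of variables occurring in it, and the projection $\phi_i$ of $\phi$ to $\mathrm{Var}(C_i)$ is the relation of all assignments to $\mathrm{Var}(C_i)$ that extend to solutions of $\phi$. $\mathcal{S}$ is constraint-projection separating if every $\mathrm{CNF}_C(\mathcal{S})$-formula $\phi$ with disconnected $G(\phi)$ contains a constraint $C_i$ such that $G(\phi_i)$ is disconnected. Bijunctive = solution set of a CNF with at most 2 literals per clause; affine = solution set of a conjunction of linear equations over GF(2); IHSB$-$ (IHSB$+$) = solution set of a CNF in which every clause has at most one positive (negative) literal and every clause with more than 2 literals has only negative (only positive) literals. $R$ is componentwise $P$ if every connected component of $G(R)$, viewed as a relation, has $P$. $R'$ is obtained from $n$-ary $R$ by identification of variables if $R'=\{b\in\{0,1\}^m:(b_{h(1)},\dots,b_{h(n)})\in R\}$ for a surjective $h:\{1,\dots,n\}\to\{1,\dots,m\}$; $R$ is safely componentwise $P$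 if $R$ and every relation obtained from $R$ by identification of variables is componentwise $P$. -}

module Defs where

open import Data.Nat using (ℕ; zero; suc; _+_; _≤_; _<_)
open import Data.Fin using (Fin; _≟_)
open import Data.Bool using (Bool; true; false; _∧_; _∨_; _xor_; if_then_else_; not)
open import Data.Vec as Vec using (Vec; []; _∷_)
open import Data.List as List using (List)
open import Data.List.Relation.Unary.All using (All)
open import Data.List.Relation.Unary.Any using (Any)
open import Data.Product using (Σ; ∃; _×_; _,_; proj₁; proj₂)
open import Relation.Binary.PropositionalEquality using (_≡_)
open import Relation.Nullary using (¬_; does)

Rel : ℕ → Set
Rel n = Vec Bool n → Bool

⟦_⟧ : ∀ {n} → Rel n → Vec Bool n → Set
⟦ R ⟧ x = R x ≡ true

hamming : ∀ {n} → Vec Bool n → Vec Bool n → ℕ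
hamming [] [] = 0
hamming (a ∷ as) (b ∷ bs) = (if a xor b then 1 else 0) + hamming as bs

Adjacent : ∀ {n} → Vec Bool n → Vec Bool n → Set
Adjacent x y = hamming x y ≡ 1

-- walks in the graph G(P) induced by the vertex set P (endpoint x is
-- assumed to lie in P; every later vertex is required to lie in P)
data Path {n} (P : Vec Bool n → Set) : Vec Bool n → Vec Bool n → Set where
  done : ∀ {x} → Path P x x
  step : ∀ {x y z} → Adjacent x y → P y → Path P y z → Path P x z

Connected : ∀ {n} → (Vec Bool n → Set) → Set
Connected P = ∀ x y → P x → P y → Path P x y

Disconnected : ∀ {n} → (Vec Bool n → Set) → Set
Disconnected P = Σ _ λ x → Σ _ λ y → P x × P y × ¬ Path P x y

Component : ∀ {n} → (Vec Bool n → Set) → Vec Bool n → Vec Bool n → Set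
Component P x y = P y × Path P x y

-- literal: variable index and polarity (true = positive literal x_i)
Literal : ℕ → Set
Literal n = Fin n × Bool

Clause : ℕ → Set
Clause n = List (Literal n)

CNF : ℕ → Set
CNF n = List (Clause n)

LitSat : ∀ {n} → Vec Bool n → Literal n → Set
LitSat x (i , b) = Vec.lookup x i ≡ b

ClauseSat : ∀ {n} → Vec Bool n → Clause n → Set
ClauseSat x c = Any (LitSat x) c

CNFSat : ∀ {n} → Vec Bool n → CNF n → Set
CNFSat x φ = All (ClauseSat x) φ

npos : ∀ {n} → Clause n → ℕ
npos List.[] = 0
npos ((i , true) List.∷ c) = suc (npos c)
npos ((i , false) List.∷ c) = npos c

nneg : ∀ {n} → Clause n → ℕ
nneg List.[] = 0
nneg ((i , true) List.∷ c) = nneg c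
nneg ((i , false) List.∷ c) = suc (nneg c)

DefinedByCNF : ∀ {n} → (Clause n → Set) → (Vec Bool n → Set) → Set
DefinedByCNF {n} ok P =
  Σ (CNF n) λ φ → All ok φ
    × (∀ x → P x → CNFSat x φ) × (∀ x → CNFSat x φ → P x)

Bijunctive : ∀ {n} → (Vec Bool n → Set) → Set
Bijunctive = DefinedByCNF (λ c → List.length c ≤ 2)

IHSBminus : ∀ {n} → (Vec Bool n → Set) → Set
IHSBminus = DefinedByCNF (λ c → npos c ≤ 1 × (2 < List.length c → npos c ≡ 0))

IHSBplus : ∀ {n} → (Vec Bool n → Set) → Set
IHSBplus = DefinedByCNF (λ c → nneg c ≤ 1 × (2 < List.length c → nneg c ≡ 0))

-- affine: solution set of a system of linear equations over GF(2);
-- an equation is (coefficient vector a, right-hand side b): Σ a_i x_i = b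
Equation : ℕ → Set
Equation n = Vec Bool n × Bool

parity : ∀ {n} → Vec Bool n → Vec Bool n → Bool
parity [] [] = false
parity (a ∷ as) (x ∷ xs) = (a ∧ x) xor parity as xs

EqSat : ∀ {n} → Vec Bool n → Equation n → Set
EqSat x (a , b) = parity a x ≡ b

Affine : ∀ {n} → (Vec Bool n → Set) → Set
Affine {n} P =
  Σ (List (Equation n)) λ E →
    (∀ x → P x → All (EqSat x) E) × (∀ x → All (EqSat x) E → P x)

Componentwise : (∀ {n} → (Vec Bool n → Set) → Set) →
                ∀ {n} → (Vec Bool n → Set) → Set
Componentwise Prop P = ∀ x → P x → Prop (Component P x)

Surjective : ∀ {n m} → (Fin n → Fin m) → Set
Surjective {n} {m} h = ∀ (j : Fin m) → Σ (Fin n) λ i → h i ≡ j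

identify : ∀ {n m} → (Fin n → Fin m) → Rel n → Rel m
identify h R b = R (Vec.tabulate λ i → Vec.lookup b (h i))

SafelyComponentwise : (∀ {n} → (Vec Bool n → Set) → Set) →
                      ∀ {n} → Rel n → Set
SafelyComponentwise Prop {n} R =
  Componentwise Prop ⟦ R ⟧
  × (∀ m (h : Fin n → Fin m) → Surjective h →
       Componentwise Prop ⟦ identify h R ⟧)

Language : Set
Language = List (Σ ℕ Rel)

arity : (S : Language) → Fin (List.length S) → ℕ
arity S i = proj₁ (List.lookup S i)

relOf : (S : Language) → (i : Fin (List.length S)) → Rel (arity S i)
relOf S i = proj₂ (List.lookup S i)

data Term (m : ℕ) : Set where
  var   : Fin m → Term m
  const : Bool → Term m

evalT : ∀ {m} → Vec Bool m → Term m → Bool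
evalT x (var j) = Vec.lookup x j
evalT x (const b) = b

record Constraint (S : Language) (m : ℕ) : Set where
  constructor _⦅_⦆
  field
    rel  : Fin (List.length S)
    args : Vec (Term m) (arity S rel)
open Constraint public

Formula : Language → ℕ → Set
Formula S m = List (Constraint S m)

SatC : ∀ {S m} → Constraint S m → Vec Bool m → Set
SatC {S} C x = ⟦ relOf S (rel C) ⟧ (Vec.map (evalT x) (args C))

Sat : ∀ {S m} → Formula S m → Vec Bool m → Set
Sat φ x = All (λ C → SatC C x) φ

occursIn : ∀ {m k} → Fin m → Vec (Term m) k → Bool
occursIn i [] = false
occursIn i (var j ∷ ts) = does (i Data.Fin.≟ j) ∨ occursIn i ts
occursIn i (const _ ∷ ts) = occursIn i ts

filterB : ∀ {A : Set} → (A → Bool) → List A → List A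
filterB p List.[] = List.[]
filterB p (a List.∷ as) = if p a then a List.∷ filterB p as else filterB p as

-- the variables of C, listed in increasing order without repetition
varList : ∀ {S m} → Constraint S m → List (Fin m)
varList {m = m} C = filterB (λ i → occursIn i (args C)) (List.allFin m)

Var : ∀ {S m} (C : Constraint S m) → Vec (Fin m) (List.length (varList C))
Var C = Vec.fromList (varList C)

Proj : ∀ {S m} → Formula S m → (C : Constraint S m) →
       Vec Bool (List.length (varList C)) → Set
Proj {m = m} φ C b =
  Σ (Vec Bool m) λ x → Sat φ x × Vec.map (Vec.lookup x) (Var C) ≡ b

ConstraintProjectionSeparating : Language → Set
ConstraintProjectionSeparating S =
  ∀ m (φ : Formula S m) → Disconnected (Sat φ) →
    Any (λ C → Disconnected (Proj φ C)) φ

module Submission where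

-- Given solutions u, v of φ, induction on their Hamming distance shows that u and v are connected
-- in G(φ) or some projection φ_C is disconnected: when d(u,v) ≥ 2 it suffices to find a solution
-- strictly between u and v.  A candidate w strictly between them that is not a solution violates
-- some constraint C; unless φ_C separates u from v (or from an auxiliary solution z), the class of
-- the relations forces w to satisfy C after all.
-- For affine relations, a connected set closed under x ⊕ y ⊕ z contains every point between two
-- of its members.  In the other three classes every component of a relation, even after
-- identifying variables, is closed under an operation g with g(p,p,r) = p: majority, x ∧ (y ∨ z)
-- or x ∨ (y ∧ z).  A solution z with g(u,v,z) or g(v,u,z) strictly between u and v yields a
-- candidate; if there is none, g(u,v,·) and g(v,u,·) map all solutions onto {u, v}, so a path
-- from u to v in φ_C forces u and v to differ in at most one variable of C.

open import Algebra.Bundles using (CommutativeRing)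
import Algebra.Properties.CommutativeSemigroup as CommSemigroupProperties
open import Data.Bool using (Bool; true; false; _∧_; _∨_; _xor_; T; if_then_else_)
open import Data.Bool.Properties
  using (T-∨; ∧-distribˡ-xor; xor-∧-commutativeRing; xor-same; xor-assoc; xor-identityʳ)
  renaming (_≟_ to _≟ᵇ_)
open import Data.Empty using (⊥-elim)
open import Data.Fin using (Fin; zero; suc; _↑ˡ_; _↑ʳ_) renaming (_≟_ to _≟ᶠ_)
open import Data.Fin.Properties using (0≢1+n; suc-injective)
import Data.Fin.Properties as FinP
open import Data.List as List using (List)
open import Data.List.Membership.Propositional using (_∈_; find; lose)
open import Data.List.Membership.Propositional.Properties
  using (∈-allFin; ∈-lookup; ∈-map⁺; ∈-map⁻; ∈-deduplicate⁺; ∈-deduplicate⁻)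
open import Data.List.Relation.Unary.All using (All; []; _∷_)
import Data.List.Relation.Unary.All as All
open import Data.List.Relation.Unary.All.Properties using (¬All⇒Any¬)
import Data.List.Relation.Unary.AllPairs as AllPairs
open import Data.List.Relation.Unary.Any using (Any; here; there)
import Data.List.Relation.Unary.Any as Any
import Data.List.Relation.Unary.Any.Properties as AnyP
open import Data.List.Relation.Unary.Unique.Propositional using (Unique)
open import Data.List.Relation.Unary.Unique.DecPropositional.Properties using (deduplicate-!)
open import Data.Nat using (ℕ; zero; suc; _+_; _^_; _≤_; _<_; z≤n; s≤s)
open import Data.Nat.Induction using (<-wellFounded)
import Data.Nat.Properties as ℕ
open import Data.Product using (∃; ∃-syntax; _×_; _,_; proj₁; proj₂)
open import Data.Sum using (_⊎_; inj₁; inj₂; [_,_]′)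
import Data.Sum as Sum
open import Data.Vec using (Vec; []; _∷_; _++_; lookup; tabulate)
import Data.Vec as Vec
import Data.Vec.Properties as VecP
open import Function using (_∘_; id; Equivalence)
open import Induction.WellFounded using (Acc; acc)
open import Relation.Binary.Definitions using (DecidableEquality)
open import Relation.Binary.PropositionalEquality
open import Relation.Nullary using (¬_; Dec; yes; no; does)
open import Relation.Nullary.Decidable using (map′; _×-dec_; _⊎-dec_; ¬?; decidable-stable; T?)
open import Relation.Unary using (Decidable)

open import Defs

+-interchange : ∀ a b c d → (a + b) + (c + d) ≡ (a + c) + (b + d)
+-interchange = CommSemigroupProperties.interchange ℕ.+-commutativeSemigroup

zipWith₃ : ∀ {A B C D : Set} {n} → (A → B → C → D) → Vec A n → Vec B n → Vec C n → Vec D n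
zipWith₃ g []       []       []       = []
zipWith₃ g (a ∷ as) (b ∷ bs) (c ∷ cs) = g a b c ∷ zipWith₃ g as bs cs

lookup-zipWith₃ : ∀ {A B C D : Set} {n} (g : A → B → C → D) xs ys zs (i : Fin n) →
                  lookup (zipWith₃ g xs ys zs) i ≡ g (lookup xs i) (lookup ys i) (lookup zs i)
lookup-zipWith₃ g (_ ∷ _)  (_ ∷ _)  (_ ∷ _)  zero    = refl
lookup-zipWith₃ g (_ ∷ as) (_ ∷ bs) (_ ∷ cs) (suc i) = lookup-zipWith₃ g as bs cs i

lookup-extensionality : ∀ {A : Set} {n} {xs ys : Vec A n} → (∀ i → lookup xs i ≡ lookup ys i) → xs ≡ ys
lookup-extensionality {xs = xs} {ys} eq =
  trans (sym (VecP.tabulate∘lookup xs)) (trans (VecP.tabulate-cong eq) (VecP.tabulate∘lookup ys))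

bool-between : ∀ {p q : Bool} → p ≢ q → ∀ b → b ≡ p ⊎ b ≡ q
bool-between {true}  {true}  p≢q _     = ⊥-elim (p≢q refl)
bool-between {false} {false} p≢q _     = ⊥-elim (p≢q refl)
bool-between {true}  {false} _   true  = inj₁ refl
bool-between {true}  {false} _   false = inj₂ refl
bool-between {false} {true}  _   true  = inj₂ refl
bool-between {false} {true}  _   false = inj₁ refl

bitDistance : Bool → Bool → ℕ
bitDistance a b = if a xor b then 1 else 0

bitDistance-self : ∀ a → bitDistance a a ≡ 0
bitDistance-self true  = refl
bitDistance-self false = refl

bitDistance-≤1 : ∀ a b → bitDistance a b ≤ 1
bitDistance-≤1 true  true  = z≤n
bitDistance-≤1 true  false = s≤s z≤n
bitDistance-≤1 false true  = s≤s z≤n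
bitDistance-≤1 false false = z≤n

bitDistance-map : ∀ (f : Bool → Bool) a b → bitDistance (f a) (f b) ≤ bitDistance a b
bitDistance-map f true  true  = ℕ.≤-reflexive (bitDistance-self (f true))
bitDistance-map f false false = ℕ.≤-reflexive (bitDistance-self (f false))
bitDistance-map f true  false = bitDistance-≤1 (f true) (f false)
bitDistance-map f false true  = bitDistance-≤1 (f false) (f true)

hamming-refl : ∀ {n} (x : Vec Bool n) → hamming x x ≡ 0
hamming-refl []      = refl
hamming-refl (a ∷ x) = cong₂ _+_ (bitDistance-self a) (hamming-refl x)

hamming≡0⇒≡ : ∀ {n} {x y : Vec Bool n} → hamming x y ≡ 0 → x ≡ y
hamming≡0⇒≡ {x = []}        {[]}        _ = refl
hamming≡0⇒≡ {x = true ∷ _}  {true ∷ _}  e = cong (true ∷_) (hamming≡0⇒≡ e)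
hamming≡0⇒≡ {x = false ∷ _} {false ∷ _} e = cong (false ∷_) (hamming≡0⇒≡ e)

≢⇒hamming-pos : ∀ {n} {x y : Vec Bool n} → x ≢ y → 0 < hamming x y
≢⇒hamming-pos {x = x} {y} x≢y with hamming x y in eq
... | zero  = ⊥-elim (x≢y (hamming≡0⇒≡ eq))
... | suc _ = s≤s z≤n

hamming-zipWith₃-≤ : ∀ {n} (g : Bool → Bool → Bool → Bool) (a c x y : Vec Bool n) →
                     hamming (zipWith₃ g a c x) (zipWith₃ g a c y) ≤ hamming x y
hamming-zipWith₃-≤ g []       []       []       []       = z≤n
hamming-zipWith₃-≤ g (a ∷ as) (c ∷ cs) (x ∷ xs) (y ∷ ys) =
  ℕ.+-mono-≤ (bitDistance-map (g a c) x y) (hamming-zipWith₃-≤ g as cs xs ys)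

AtMostOneDifference : ∀ {n} → Vec Bool n → Vec Bool n → Set
AtMostOneDifference x y = ∀ {i j} → lookup x i ≢ lookup y i → lookup x j ≢ lookup y j → i ≡ j

tails-equal : ∀ {n a b} {x y : Vec Bool n} → a ≢ b → hamming (a ∷ x) (b ∷ y) ≤ 1 → x ≡ y
tails-equal {a = true}  {true}  a≢b _       = ⊥-elim (a≢b refl)
tails-equal {a = false} {false} a≢b _       = ⊥-elim (a≢b refl)
tails-equal {a = true}  {false} _   (s≤s h) = hamming≡0⇒≡ (ℕ.n≤0⇒n≡0 h)
tails-equal {a = false} {true}  _   (s≤s h) = hamming≡0⇒≡ (ℕ.n≤0⇒n≡0 h)

hamming≤1⇒AtMostOneDifference : ∀ {n} {x y : Vec Bool n} → hamming x y ≤ 1 → AtMostOneDifference x y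
hamming≤1⇒AtMostOneDifference {x = _ ∷ _} {_ ∷ _} h {zero}  {zero}  _  _  = refl
hamming≤1⇒AtMostOneDifference {x = _ ∷ x} {_ ∷ y} h {zero}  {suc j} d₁ d₂ =
  ⊥-elim (d₂ (cong (λ v → lookup v j) (tails-equal {x = x} {y} d₁ h)))
hamming≤1⇒AtMostOneDifference {x = _ ∷ x} {_ ∷ y} h {suc i} {zero}  d₁ d₂ =
  ⊥-elim (d₁ (cong (λ v → lookup v i) (tails-equal {x = x} {y} d₂ h)))
hamming≤1⇒AtMostOneDifference {x = a ∷ x} {b ∷ y} h {suc i} {suc j} d₁ d₂ =
  cong suc (hamming≤1⇒AtMostOneDifference {x = x} {y} (ℕ.≤-trans (ℕ.m≤n+m _ (bitDistance a b)) h) d₁ d₂)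

AtMostOneDifference⇒hamming≤1 : ∀ {n} {x y : Vec Bool n} → AtMostOneDifference x y → hamming x y ≤ 1
AtMostOneDifference⇒hamming≤1 {x = []}    {[]}    _ = z≤n
AtMostOneDifference⇒hamming≤1 {x = a ∷ x} {b ∷ y} u with a ≟ᵇ b
... | yes refl = ℕ.≤-trans (ℕ.≤-reflexive (cong (_+ hamming x y) (bitDistance-self a)))
                   (AtMostOneDifference⇒hamming≤1 {x = x} {y} (λ d₁ d₂ → suc-injective (u d₁ d₂)))
... | no a≢b = ℕ.+-mono-≤ (bitDistance-≤1 a b) (ℕ.≤-reflexive (trans (cong (hamming x) (sym x≡y)) (hamming-refl x)))
  where
  x≡y : x ≡ y
  x≡y = lookup-extensionality λ j →
          decidable-stable (lookup x j ≟ᵇ lookup y j) (λ d → 0≢1+n (u a≢b d))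

Between : ∀ {n} → Vec Bool n → Vec Bool n → Vec Bool n → Set
Between a w c = ∀ i → lookup w i ≡ lookup a i ⊎ lookup w i ≡ lookup c i

StrictlyBetween : ∀ {n} → Vec Bool n → Vec Bool n → Vec Bool n → Set
StrictlyBetween a w c = Between a w c × w ≢ a × w ≢ c

between-sym : ∀ {n} {a w c : Vec Bool n} → Between a w c → Between c w a
between-sym btw = Sum.swap ∘ btw

between-self : ∀ {n} {a w : Vec Bool n} → Between a w a → w ≡ a
between-self btw = lookup-extensionality λ i → [ id , id ]′ (btw i)

between-hamming : ∀ {n} {a w c : Vec Bool n} → Between a w c → hamming a w + hamming w c ≡ hamming a c
between-hamming {a = []}     {[]}     {[]}     _   = refl
between-hamming {a = a ∷ as} {w ∷ ws} {c ∷ cs} btw =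
  trans (+-interchange (bitDistance a w) _ (bitDistance w c) _)
        (cong₂ _+_ (bit (btw zero)) (between-hamming {a = as} {ws} {cs} (btw ∘ suc)))
  where
  bit : ∀ {a w c} → w ≡ a ⊎ w ≡ c → bitDistance a w + bitDistance w c ≡ bitDistance a c
  bit {true}  {c = true}  (inj₁ refl) = refl
  bit {true}  {c = false} (inj₁ refl) = refl
  bit {false} {c = true}  (inj₁ refl) = refl
  bit {false} {c = false} (inj₁ refl) = refl
  bit {true}  {c = true}  (inj₂ refl) = refl
  bit {true}  {c = false} (inj₂ refl) = refl
  bit {false} {c = true}  (inj₂ refl) = refl
  bit {false} {c = false} (inj₂ refl) = refl

zipWith₃-between : ∀ {n} (g : Bool → Bool → Bool → Bool) → (∀ p r → g p p r ≡ p) →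
                   (a c z : Vec Bool n) → Between a (zipWith₃ g a c z) c
zipWith₃-between g g-idem a c z i rewrite lookup-zipWith₃ g a c z i = pointwise (lookup a i) (lookup c i) (lookup z i)
  where
  pointwise : ∀ p q r → g p q r ≡ p ⊎ g p q r ≡ q
  pointwise p q r with p ≟ᵇ q
  ... | yes refl = inj₁ (g-idem p r)
  ... | no p≢q   = bool-between p≢q (g p q r)

between-∷ : ∀ {n} {b} {as w cs : Vec Bool n} → Between as w cs → Between (b ∷ as) (b ∷ w) (b ∷ cs)
between-∷ btw zero    = inj₁ refl
between-∷ btw (suc i) = btw i

step-towards : ∀ {n} {a c : Vec Bool n} → a ≢ c → ∃[ w ] Between a w c × hamming a w ≡ 1
step-towards {a = []}         {[]}         a≢c = ⊥-elim (a≢c refl)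
step-towards {a = true ∷ as}  {false ∷ cs} _   =
  false ∷ as , (λ { zero → inj₂ refl ; (suc i) → inj₁ refl }) , cong suc (hamming-refl as)
step-towards {a = false ∷ as} {true ∷ cs}  _   =
  true ∷ as , (λ { zero → inj₂ refl ; (suc i) → inj₁ refl }) , cong suc (hamming-refl as)
step-towards {a = true ∷ as}  {true ∷ cs}  a≢c with step-towards (a≢c ∘ cong (true ∷_))
... | w , btw , d = true ∷ w , between-∷ btw , d
step-towards {a = false ∷ as} {false ∷ cs} a≢c with step-towards (a≢c ∘ cong (false ∷_))
... | w , btw , d = false ∷ w , between-∷ btw , d

interior-point : ∀ {n} {a c : Vec Bool n} → 2 ≤ hamming a c → ∃[ w ] StrictlyBetween a w c
interior-point {a = a} {c} 2≤d = strictly (step-towards a≢c)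
  where
  a≢c : a ≢ c
  a≢c refl with () ← subst (2 ≤_) (hamming-refl a) 2≤d
  strictly : ∃[ w ] Between a w c × hamming a w ≡ 1 → ∃[ w ] StrictlyBetween a w c
  strictly (w , btw , d₁) = w , btw , w≢a , w≢c
    where
    w≢a : w ≢ a
    w≢a refl with () ← trans (sym (hamming-refl w)) d₁
    w≢c : w ≢ c
    w≢c refl with s≤s () ← subst (2 ≤_) d₁ 2≤d

-- Paths and decidability of connectivity

NonExpanding : ∀ {n k} → (Vec Bool n → Vec Bool k) → Set
NonExpanding F = ∀ {a b} → Adjacent a b → hamming (F a) (F b) ≤ 1

Path-++ : ∀ {n} {P : Vec Bool n → Set} {x y z} → Path P x y → Path P y z → Path P x z
Path-++ done           q = q
Path-++ (step a py p)  q = step a py (Path-++ p q)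

Path-snoc : ∀ {n} {P : Vec Bool n → Set} {x y z} → Path P x y → Adjacent y z → P z → Path P x z
Path-snoc p a pz = Path-++ p (step a pz done)

Path-target : ∀ {n} {P : Vec Bool n → Set} {x y} → P x → Path P x y → P y
Path-target px done          = px
Path-target _  (step _ py p) = Path-target py p

Path-map : ∀ {n k} {P : Vec Bool n → Set} {Q : Vec Bool k → Set} (F : Vec Bool n → Vec Bool k) →
           NonExpanding F → (∀ {a} → P a → Q (F a)) → ∀ {x y} → Path P x y → Path Q (F x) (F y)
Path-map F F-ne PQ done = done
Path-map F F-ne PQ {x} (step {y = y} a py p) with hamming (F x) (F y) in eq | F-ne {x} {y} a
... | zero        | _       rewrite hamming≡0⇒≡ {x = F x} {F y} eq = Path-map F F-ne PQ p
... | suc zero    | _       = step eq (PQ py) (Path-map F F-ne PQ p)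
... | suc (suc _) | s≤s ()

two-valued-Path⇒hamming≤1 : ∀ {n k} {Q : Vec Bool n → Set} (G : Vec Bool n → Vec Bool k) {a c} →
  NonExpanding G → (∀ {b} → Q b → G b ≡ a ⊎ G b ≡ c) →
  ∀ {x y} → G x ≡ a → G y ≡ c → Path Q x y → hamming a c ≤ 1
two-valued-Path⇒hamming≤1 G G-ne two {x} Gx Gy done =
  ℕ.≤-trans (ℕ.≤-reflexive (trans (cong₂ hamming (sym Gx) (sym Gy)) (hamming-refl (G x)))) z≤n
two-valued-Path⇒hamming≤1 G G-ne two Gx Gy (step {y = y} a qy p) with two qy
... | inj₁ Gy′ = two-valued-Path⇒hamming≤1 G G-ne two Gy′ Gy p
... | inj₂ Gy′ = subst (_≤ 1) (cong₂ hamming Gx Gy′) (G-ne a)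

∃? : ∀ {n} {P : Vec Bool n → Set} → Decidable P → Dec (∃ P)
∃? {zero}  P? = map′ ([] ,_) (λ { ([] , p) → p }) (P? [])
∃? {suc n} P? = map′ [ (λ (v , p) → true ∷ v , p) , (λ (v , p) → false ∷ v , p) ]′ split
                     (∃? (P? ∘ (true ∷_)) ⊎-dec ∃? (P? ∘ (false ∷_)))
  where
  split : ∀ {P : Vec Bool (suc n) → Set} → ∃ P → ∃ (P ∘ (true ∷_)) ⊎ ∃ (P ∘ (false ∷_))
  split (true ∷ v , p)  = inj₁ (v , p)
  split (false ∷ v , p) = inj₂ (v , p)

_⊆ᵇ_ : ∀ {n} → (Vec Bool n → Bool) → (Vec Bool n → Bool) → Set
S ⊆ᵇ S′ = ∀ v → T (S v) → T (S′ v)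

count : ∀ {n} → (Vec Bool n → Bool) → ℕ
count {zero}  S = if S [] then 1 else 0
count {suc n} S = count (S ∘ (true ∷_)) + count (S ∘ (false ∷_))

count-≤ : ∀ {n} (S : Vec Bool n → Bool) → count S ≤ 2 ^ n
count-≤ {zero}  S with S []
... | true  = s≤s z≤n
... | false = z≤n
count-≤ {suc n} S = ℕ.+-mono-≤ (count-≤ (S ∘ (true ∷_)))
                      (ℕ.≤-trans (count-≤ (S ∘ (false ∷_))) (ℕ.m≤m+n (2 ^ n) 0))

count-mono : ∀ {n} {S S′ : Vec Bool n → Bool} → S ⊆ᵇ S′ → count S ≤ count S′
count-mono {zero} {S} {S′} S⊆S′ with S [] | S′ [] | S⊆S′ []
... | true  | true  | _ = ℕ.≤-refl
... | true  | false | f = ⊥-elim (f _)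
... | false | _     | _ = z≤n
count-mono {suc n} S⊆S′ = ℕ.+-mono-≤ (count-mono (S⊆S′ ∘ (true ∷_))) (count-mono (S⊆S′ ∘ (false ∷_)))

count-mono-< : ∀ {n} {S S′ : Vec Bool n → Bool} → S ⊆ᵇ S′ → ∀ v → ¬ T (S v) → T (S′ v) → count S < count S′
count-mono-< {zero} {S} {S′} _ [] v∉S v∈S′ with S [] | S′ []
... | true  | _    = ⊥-elim (v∉S _)
... | false | true = s≤s z≤n
count-mono-< {suc n} S⊆S′ (true ∷ v) v∉S v∈S′ =
  ℕ.+-mono-<-≤ (count-mono-< (S⊆S′ ∘ (true ∷_)) v v∉S v∈S′) (count-mono (S⊆S′ ∘ (false ∷_)))
count-mono-< {suc n} S⊆S′ (false ∷ v) v∉S v∈S′ =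
  ℕ.+-mono-≤-< (count-mono (S⊆S′ ∘ (true ∷_))) (count-mono-< (S⊆S′ ∘ (false ∷_)) v v∉S v∈S′)

T-does⇒ : ∀ {A : Set} (d : Dec A) → T (does d) → A
T-does⇒ (yes a) _ = a

⇒T-does : ∀ {A : Set} (d : Dec A) → A → T (does d)
⇒T-does (yes _) _ = _
⇒T-does (no ¬a) a = ¬a a

_≟ᵛ_ : ∀ {n} (x y : Vec Bool n) → Dec (x ≡ y)
_≟ᵛ_ = VecP.≡-dec _≟ᵇ_

adjacent? : ∀ {n} (x y : Vec Bool n) → Dec (Adjacent x y)
adjacent? x y = hamming x y ℕ.≟ 1

module Reachability {n} {P : Vec Bool n → Set} (P? : Decidable P) (x : Vec Bool n) where

  Sound : (Vec Bool n → Bool) → Set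
  Sound S = ∀ {y} → T (S y) → Path P x y

  Closed : (Vec Bool n → Bool) → Set
  Closed S = ∀ {y z} → T (S y) → Adjacent y z → P z → T (S z)

  Frontier : (Vec Bool n → Bool) → Vec Bool n → Set
  Frontier S z = P z × ∃[ y ] T (S y) × Adjacent y z

  frontier? : ∀ S → Decidable (Frontier S)
  frontier? S z = P? z ×-dec ∃? (λ y → T? (S y) ×-dec adjacent? y z)

  grow : (Vec Bool n → Bool) → Vec Bool n → Bool
  grow S z = S z ∨ does (frontier? S z)

  grow-⊇ : ∀ S → S ⊆ᵇ grow S
  grow-⊇ S v v∈S = Equivalence.from T-∨ (inj₁ v∈S)

  grow-sound : ∀ S → Sound S → Sound (grow S)
  grow-sound S sound {z} z∈ with Equivalence.to T-∨ z∈
  ... | inj₁ z∈S      = sound z∈S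
  ... | inj₂ frontier with T-does⇒ (frontier? S z) frontier
  ... | pz , y , y∈S , adj = Path-snoc (sound y∈S) adj pz

  stable⇒closed : ∀ S → grow S ⊆ᵇ S → Closed S
  stable⇒closed S stable {y} {z} y∈S adj pz =
    stable z (Equivalence.from T-∨ (inj₂ (⇒T-does (frontier? S z) (pz , y , y∈S , adj))))

  Saturated : Set
  Saturated = ∃[ S ] Sound S × T (S x) × Closed S

  -- Every productive round adds a vertex to S, and S ⊆ {0,1}ⁿ, so the fuel cannot run out.
  saturate : ∀ fuel S → Sound S → T (S x) → 2 ^ n < fuel + count S → Saturated
  saturate zero S _ _ overflow = ⊥-elim (ℕ.<⇒≱ overflow (count-≤ S))
  saturate (suc fuel) S sound x∈S overflow with ∃? (λ z → T? (grow S z) ×-dec ¬? (T? (S z)))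
  ... | yes (z , z∈grow , z∉S) =
    saturate fuel (grow S) (grow-sound S sound) (grow-⊇ S x x∈S)
      (ℕ.≤-trans overflow (ℕ.≤-trans (ℕ.≤-reflexive (sym (ℕ.+-suc fuel (count S))))
                                     (ℕ.+-monoʳ-≤ fuel (count-mono-< (grow-⊇ S) z z∉S z∈grow))))
  ... | no none =
    S , sound , x∈S , stable⇒closed S λ z z∈grow →
      decidable-stable (T? (S z)) (λ z∉S → none (z , z∈grow , z∉S))

  closed-Path : ∀ {S} → Closed S → ∀ {a y} → T (S a) → Path P a y → T (S y)
  closed-Path closed a∈S done             = a∈S
  closed-Path closed a∈S (step adj pb p)  = closed-Path closed (closed a∈S adj pb) p

  singleton-sound : Sound (λ v → does (v ≟ᵛ x))
  singleton-sound {y} y∈ = subst (Path P x) (sym (T-does⇒ (y ≟ᵛ x) y∈)) done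

  Path? : ∀ y → Dec (Path P x y)
  Path? y with saturate (suc (2 ^ n)) (λ v → does (v ≟ᵛ x)) singleton-sound (⇒T-does (x ≟ᵛ x) refl)
                        (s≤s (ℕ.m≤m+n (2 ^ n) _))
  ... | S , sound , x∈S , closed = map′ sound (closed-Path closed x∈S) (T? (S y))

open Reachability using (Path?)

-- Polymorphisms of the four classes

cong₃ : ∀ {A B C D : Set} (f : A → B → C → D) {a a′ b b′ c c′} →
        a ≡ a′ → b ≡ b′ → c ≡ c′ → f a b c ≡ f a′ b′ c′
cong₃ f refl refl refl = refl

ClosedUnder : ∀ {n} → (Bool → Bool → Bool → Bool) → (Vec Bool n → Set) → Set
ClosedUnder g P = ∀ {a b c} → P a → P b → P c → P (zipWith₃ g a b c)

LitSat-zipWith₃ : ∀ {n} {g : Bool → Bool → Bool → Bool} {a b c : Vec Bool n} {i p} →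
                  g (lookup a i) (lookup b i) (lookup c i) ≡ p → LitSat (zipWith₃ g a b c) (i , p)
LitSat-zipWith₃ {g = g} {a} {b} {c} {i} eq = trans (lookup-zipWith₃ g a b c i) eq

CNF-closed : ∀ {n} {ok : Clause n → Set} {g} → (∀ {c} → ok c → ClosedUnder g (λ x → ClauseSat x c)) →
             ∀ {P} → DefinedByCNF ok P → ClosedUnder g P
CNF-closed {ok = ok} {g} clause-closed (φ , oks , sound , complete) {a} {b} {c} pa pb pc =
  complete _ (go oks (sound a pa) (sound b pb) (sound c pc))
  where
  go : ∀ {ψ} → All ok ψ → CNFSat a ψ → CNFSat b ψ → CNFSat c ψ → CNFSat (zipWith₃ g a b c) ψ
  go []         []         []         []         = []
  go (o ∷ oks′) (sa ∷ sas) (sb ∷ sbs) (sc ∷ scs) = clause-closed o {a} {b} {c} sa sb sc ∷ go oks′ sas sbs scs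

two-literals : ∀ {n} {x : Vec Bool n} {l₁ l₂} → ClauseSat x (l₁ List.∷ l₂ List.∷ List.[]) → LitSat x l₁ ⊎ LitSat x l₂
two-literals (here s)         = inj₁ s
two-literals (there (here s)) = inj₂ s

from-two-literals : ∀ {n} {x : Vec Bool n} {l₁ l₂} → LitSat x l₁ ⊎ LitSat x l₂ → ClauseSat x (l₁ List.∷ l₂ List.∷ List.[])
from-two-literals (inj₁ s) = here s
from-two-literals (inj₂ s) = there (here s)

majority : Bool → Bool → Bool → Bool
majority true  y z = y ∨ z
majority false y z = y ∧ z

majority-xxy : ∀ {x y z p} → x ≡ p → y ≡ p → majority x y z ≡ p
majority-xxy {p = true}  refl refl = refl
majority-xxy {p = false} refl refl = refl

majority-xyx : ∀ {x y z p} → x ≡ p → z ≡ p → majority x y z ≡ p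
majority-xyx {y = true}  {p = true}  refl refl = refl
majority-xyx {y = false} {p = true}  refl refl = refl
majority-xyx {y = true}  {p = false} refl refl = refl
majority-xyx {y = false} {p = false} refl refl = refl

majority-yxx : ∀ x {y z p} → y ≡ p → z ≡ p → majority x y z ≡ p
majority-yxx true  {p = true}  refl refl = refl
majority-yxx false {p = true}  refl refl = refl
majority-yxx true  {p = false} refl refl = refl
majority-yxx false {p = false} refl refl = refl

majority-2-clause : ∀ {n} {c : Clause n} → List.length c ≤ 2 → ClosedUnder majority (λ x → ClauseSat x c)
majority-2-clause {c = List.[]} _ () _ _
majority-2-clause {c = (i , _) List.∷ List.[]} _ {a} {b} {d} (here α) (here β) (here _) =
  here (LitSat-zipWith₃ {a = a} {b} {d} {i} (majority-xxy α β))
majority-2-clause {c = l₁@(i , _) List.∷ l₂@(j , _) List.∷ List.[]} _ {a} {b} {d} sa sb sd =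
  from-two-literals {x = r} (pick (two-literals {x = a} sa) (two-literals {x = b} sb) (two-literals {x = d} sd))
  where
  r = zipWith₃ majority a b d
  lit : ∀ {i p} → majority (lookup a i) (lookup b i) (lookup d i) ≡ p → LitSat r (i , p)
  lit = LitSat-zipWith₃ {a = a} {b} {d}
  pick : LitSat a l₁ ⊎ LitSat a l₂ → LitSat b l₁ ⊎ LitSat b l₂ → LitSat d l₁ ⊎ LitSat d l₂ →
         LitSat r l₁ ⊎ LitSat r l₂
  pick (inj₁ α) (inj₁ β) _        = inj₁ (lit {i} (majority-xxy α β))
  pick (inj₂ α) (inj₂ β) _        = inj₂ (lit {j} (majority-xxy α β))
  pick (inj₁ α) (inj₂ _) (inj₁ δ) = inj₁ (lit {i} (majority-xyx α δ))
  pick (inj₂ α) (inj₁ _) (inj₂ δ) = inj₂ (lit {j} (majority-xyx α δ))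
  pick (inj₁ _) (inj₂ β) (inj₂ δ) = inj₂ (lit {j} (majority-yxx (lookup a j) β δ))
  pick (inj₂ _) (inj₁ β) (inj₁ δ) = inj₁ (lit {i} (majority-yxx (lookup a i) β δ))
majority-2-clause {c = _ List.∷ _ List.∷ _ List.∷ _} (s≤s (s≤s ()))

-- ihsb s preserves the clauses with at most one literal of polarity s, and none if the clause is
-- longer than 2: s = true gives the IHSB− clauses, s = false the IHSB+ clauses.

ihsb : Bool → Bool → Bool → Bool → Bool
ihsb true  x y z = x ∧ (y ∨ z)
ihsb false x y z = x ∨ (y ∧ z)

ihsb-keep : ∀ s {x y z p} → p ≢ s → x ≡ p → ihsb s x y z ≡ p
ihsb-keep true  {p = false} _   refl = refl
ihsb-keep false {p = true}  _   refl = refl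
ihsb-keep true  {p = true}  p≢s _    = ⊥-elim (p≢s refl)
ihsb-keep false {p = false} p≢s _    = ⊥-elim (p≢s refl)

ihsb-hit : ∀ s {x y z} → x ≡ s → y ≡ s ⊎ z ≡ s → ihsb s x y z ≡ s
ihsb-hit true              refl (inj₁ refl) = refl
ihsb-hit true  {y = true}  refl (inj₂ refl) = refl
ihsb-hit true  {y = false} refl (inj₂ refl) = refl
ihsb-hit false             refl (inj₁ refl) = refl
ihsb-hit false {y = true}  refl (inj₂ refl) = refl
ihsb-hit false {y = false} refl (inj₂ refl) = refl

ihsb-both : ∀ s x {y z p} → p ≢ s → y ≡ p → z ≡ p → ihsb s x y z ≡ p
ihsb-both true  true  {p = false} _   refl refl = refl
ihsb-both true  false {p = false} _   refl refl = refl
ihsb-both false true  {p = true}  _   refl refl = refl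
ihsb-both false false {p = true}  _   refl refl = refl
ihsb-both true  _     {p = true}  p≢s _    _    = ⊥-elim (p≢s refl)
ihsb-both false _     {p = false} p≢s _    _    = ⊥-elim (p≢s refl)

polarityCount : ∀ {n} → Bool → Clause n → ℕ
polarityCount true  = npos
polarityCount false = nneg

IHSBShape : ∀ {n} → Bool → Clause n → Set
IHSBShape s c = polarityCount s c ≤ 1 × (2 < List.length c → polarityCount s c ≡ 0)

polarityCount-same : ∀ {n} s (i : Fin n) c → polarityCount s ((i , s) List.∷ c) ≡ suc (polarityCount s c)
polarityCount-same true  _ _ = refl
polarityCount-same false _ _ = refl

polarityCount-other : ∀ {n s p} (i : Fin n) c → p ≢ s → polarityCount s ((i , p) List.∷ c) ≡ polarityCount s c
polarityCount-other {s = true}  {false} _ _ _   = refl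
polarityCount-other {s = false} {true}  _ _ _   = refl
polarityCount-other {s = true}  {true}  _ _ p≢s = ⊥-elim (p≢s refl)
polarityCount-other {s = false} {false} _ _ p≢s = ⊥-elim (p≢s refl)

polarityCount≡0 : ∀ {n} s (c : Clause n) → polarityCount s c ≡ 0 → All (λ l → proj₂ l ≢ s) c
polarityCount≡0 s List.[] _ = []
polarityCount≡0 s ((i , p) List.∷ c) none with p ≟ᵇ s
... | yes refl with () ← trans (sym (polarityCount-same s i c)) none
... | no p≢s = p≢s ∷ polarityCount≡0 s c (trans (sym (polarityCount-other i c p≢s)) none)

data HornShape {n} (s : Bool) : Clause n → Set where
  no-s     : ∀ {c} → All (λ l → proj₂ l ≢ s) c → HornShape s c
  unit     : ∀ i → HornShape s ((i , s) List.∷ List.[])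
  implies  : ∀ i {l} → proj₂ l ≢ s → HornShape s ((i , s) List.∷ l List.∷ List.[])
  implies′ : ∀ i {l} → proj₂ l ≢ s → HornShape s (l List.∷ (i , s) List.∷ List.[])

horn-shape : ∀ {n} s (c : Clause n) → IHSBShape s c → HornShape s c
horn-shape s List.[] _ = no-s []
horn-shape s ((i , p) List.∷ List.[]) _ with p ≟ᵇ s
... | yes refl = unit i
... | no p≢s   = no-s (p≢s ∷ [])
horn-shape s ((i , p) List.∷ (j , q) List.∷ List.[]) (≤1 , _) with p ≟ᵇ s | q ≟ᵇ s
... | yes refl | yes refl with s≤s () ←
  subst (_≤ 1) (trans (polarityCount-same s i _) (cong suc (polarityCount-same s j _))) ≤1
... | yes refl | no q≢s   = implies i q≢s
... | no p≢s   | yes refl = implies′ j p≢s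
... | no p≢s   | no q≢s   = no-s (p≢s ∷ q≢s ∷ [])
horn-shape s c@(_ List.∷ _ List.∷ _ List.∷ _) (_ , big) =
  no-s (polarityCount≡0 s c (big (s≤s (s≤s (s≤s z≤n)))))

ihsb-clause : ∀ {n} s {c : Clause n} → IHSBShape s c → ClosedUnder (ihsb s) (λ x → ClauseSat x c)
ihsb-clause s {c} shape {a} {b} {d} = closed (horn-shape s c shape)
  where
  r = zipWith₃ (ihsb s) a b d
  lit : ∀ {i p} → ihsb s (lookup a i) (lookup b i) (lookup d i) ≡ p → LitSat r (i , p)
  lit = LitSat-zipWith₃ {a = a} {b} {d}
  horn : ∀ {i j q} → q ≢ s →
         LitSat a (i , s) ⊎ LitSat a (j , q) → LitSat b (i , s) ⊎ LitSat b (j , q) →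
         LitSat d (i , s) ⊎ LitSat d (j , q) → LitSat r (i , s) ⊎ LitSat r (j , q)
  horn         q≢s (inj₂ α) _        _        = inj₂ (lit (ihsb-keep s q≢s α))
  horn         q≢s (inj₁ α) (inj₁ β) _        = inj₁ (lit (ihsb-hit s α (inj₁ β)))
  horn         q≢s (inj₁ α) (inj₂ _) (inj₁ δ) = inj₁ (lit (ihsb-hit s α (inj₂ δ)))
  horn {j = j} q≢s (inj₁ _) (inj₂ β) (inj₂ δ) = inj₂ (lit (ihsb-both s (lookup a j) q≢s β δ))
  closed : HornShape s c → ClauseSat a c → ClauseSat b c → ClauseSat d c → ClauseSat r c
  closed (no-s pol) sa _ _ with find sa
  ... | (i , p) , mem , α = lose mem (lit (ihsb-keep s (All.lookup pol mem) α))
  closed (unit i) (here α) (here β) (here _) = here (lit (ihsb-hit s α (inj₁ β)))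
  closed (implies i q≢s) sa sb sd =
    from-two-literals {x = r}
      (horn q≢s (two-literals {x = a} sa) (two-literals {x = b} sb) (two-literals {x = d} sd))
  closed (implies′ i q≢s) sa sb sd =
    from-two-literals {x = r} (Sum.swap
      (horn q≢s (Sum.swap (two-literals {x = a} sa)) (Sum.swap (two-literals {x = b} sb))
                (Sum.swap (two-literals {x = d} sd))))

xor₃ : Bool → Bool → Bool → Bool
xor₃ x y z = x xor (y xor z)

xor₃-idem : ∀ p → xor₃ p p p ≡ p
xor₃-idem true  = refl
xor₃-idem false = refl

xor-interchange : ∀ a b c d → (a xor b) xor (c xor d) ≡ (a xor c) xor (b xor d)
xor-interchange = CommSemigroupProperties.interchange
                    (CommutativeRing.+-commutativeSemigroup xor-∧-commutativeRing)

parity-xor₃ : ∀ {n} (α x y z : Vec Bool n) →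
              parity α (zipWith₃ xor₃ x y z) ≡ xor₃ (parity α x) (parity α y) (parity α z)
parity-xor₃ []      []      []      []      = refl
parity-xor₃ (α ∷ A) (x ∷ X) (y ∷ Y) (z ∷ Z) = begin
  (α ∧ xor₃ x y z) xor parity A (zipWith₃ xor₃ X Y Z)
    ≡⟨ cong₂ _xor_ distrib (parity-xor₃ A X Y Z) ⟩
  xor₃ (α ∧ x) (α ∧ y) (α ∧ z) xor xor₃ (parity A X) (parity A Y) (parity A Z)
    ≡⟨ xor-interchange (α ∧ x) _ (parity A X) _ ⟩
  ((α ∧ x) xor parity A X) xor (((α ∧ y) xor (α ∧ z)) xor (parity A Y xor parity A Z))
    ≡⟨ cong (((α ∧ x) xor parity A X) xor_) (xor-interchange (α ∧ y) _ (parity A Y) _) ⟩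
  xor₃ ((α ∧ x) xor parity A X) ((α ∧ y) xor parity A Y) ((α ∧ z) xor parity A Z) ∎
  where
  open ≡-Reasoning
  distrib : α ∧ xor₃ x y z ≡ xor₃ (α ∧ x) (α ∧ y) (α ∧ z)
  distrib = trans (∧-distribˡ-xor α x (y xor z)) (cong ((α ∧ x) xor_) (∧-distribˡ-xor α y z))

affine-closed : ∀ {n} {P : Vec Bool n → Set} → Affine P → ClosedUnder xor₃ P
affine-closed (E , sound , complete) {x} {y} {z} px py pz =
  complete _ (go (sound x px) (sound y py) (sound z pz))
  where
  go : ∀ {E} → All (EqSat x) E → All (EqSat y) E → All (EqSat z) E → All (EqSat (zipWith₃ xor₃ x y z)) E
  go [] [] [] = []
  go {(α , b) List.∷ _} (ex ∷ exs) (ey ∷ eys) (ez ∷ ezs) =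
    trans (parity-xor₃ α x y z) (trans (cong₃ xor₃ ex ey ez) (xor₃-idem b)) ∷ go exs eys ezs

lookup-fromList : ∀ {A : Set} (xs : List A) i → lookup (Vec.fromList xs) i ≡ List.lookup xs i
lookup-fromList (x List.∷ xs) zero    = refl
lookup-fromList (x List.∷ xs) (suc i) = lookup-fromList xs i

filterB-∈ : ∀ {A : Set} (p : A → Bool) {x xs} → x ∈ xs → p x ≡ true → x ∈ filterB p xs
filterB-∈ p {xs = y List.∷ ys} (here refl) px rewrite px = here refl
filterB-∈ p {xs = y List.∷ ys} (there x∈ys) px with p y
... | true  = there (filterB-∈ p x∈ys px)
... | false = filterB-∈ p x∈ys px

occursIn-lookup : ∀ {m k} (ts : Vec (Term m) k) {i j} → lookup ts i ≡ var j → occursIn j ts ≡ true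
occursIn-lookup (var j ∷ ts) {zero} {.j} refl with j ≟ᶠ j
... | yes _  = refl
... | no j≢j = ⊥-elim (j≢j refl)
occursIn-lookup (var j′ ∷ ts)  {suc i} {j} eq with does (j ≟ᶠ j′)
... | true  = refl
... | false = occursIn-lookup ts eq
occursIn-lookup (const _ ∷ ts) {suc i} eq = occursIn-lookup ts eq

module _ {S : Language} {m : ℕ} where

  restrict : (C : Constraint S m) → Vec Bool m → Vec Bool (List.length (varList C))
  restrict C x = Vec.map (lookup x) (Var C)

  argValues : (C : Constraint S m) → Vec Bool m → Vec Bool (arity S (rel C))
  argValues C x = Vec.map (evalT x) (args C)

  arg∈varList : ∀ (C : Constraint S m) {i j} → lookup (args C) i ≡ var j → j ∈ varList C
  arg∈varList C eq = filterB-∈ (λ i → occursIn i (args C)) (∈-allFin _) (occursIn-lookup (args C) eq)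

  lookup-restrict : ∀ (C : Constraint S m) x {j} (j∈ : j ∈ varList C) →
                    lookup (restrict C x) (Any.index j∈) ≡ lookup x j
  lookup-restrict C x j∈ = begin
    lookup (restrict C x) (Any.index j∈)             ≡⟨ VecP.lookup-map (Any.index j∈) (lookup x) (Var C) ⟩
    lookup x (lookup (Var C) (Any.index j∈))         ≡⟨ cong (lookup x) (lookup-fromList (varList C) _) ⟩
    lookup x (List.lookup (varList C) (Any.index j∈)) ≡⟨ cong (lookup x) (sym (AnyP.lookup-index j∈)) ⟩
    lookup x _                                        ∎
    where open ≡-Reasoning

  argValues-restrict : ∀ (C : Constraint S m) {x y} → restrict C x ≡ restrict C y → argValues C x ≡ argValues C y
  argValues-restrict C {x} {y} eq = lookup-extensionality λ i → begin
    lookup (argValues C x) i       ≡⟨ VecP.lookup-map i (evalT x) (args C) ⟩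
    evalT x (lookup (args C) i)    ≡⟨ agree (lookup (args C) i) refl ⟩
    evalT y (lookup (args C) i)    ≡⟨ VecP.lookup-map i (evalT y) (args C) ⟨
    lookup (argValues C y) i       ∎
    where
    open ≡-Reasoning
    agree : ∀ {i} t → lookup (args C) i ≡ t → evalT x t ≡ evalT y t
    agree (const _) _ = refl
    agree (var j)   t≡ = trans (sym (lookup-restrict C x j∈))
                           (trans (cong (λ v → lookup v (Any.index j∈)) eq) (lookup-restrict C y j∈))
      where j∈ = arg∈varList C t≡

  SatC-restrict : ∀ (C : Constraint S m) {x y} → restrict C x ≡ restrict C y → SatC C x → SatC C y
  SatC-restrict C eq = subst ⟦ relOf S (rel C) ⟧ (argValues-restrict C eq)

  Proj-restrict : ∀ {φ : Formula S m} C {x} → Sat φ x → Proj φ C (restrict C x)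
  Proj-restrict C {x} sx = x , sx , refl

  Proj⇒SatC : ∀ {φ : Formula S m} {C} → C ∈ φ → ∀ {x} → Proj φ C (restrict C x) → SatC C x
  Proj⇒SatC {C = C} C∈φ (y , sy , eq) = SatC-restrict C eq (All.lookup sy C∈φ)

  restrict-between : ∀ (C : Constraint S m) {a w c} → Between a w c →
                     Between (restrict C a) (restrict C w) (restrict C c)
  restrict-between C {a} {w} {c} btw i
    rewrite VecP.lookup-map i (lookup a) (Var C) | VecP.lookup-map i (lookup w) (Var C)
          | VecP.lookup-map i (lookup c) (Var C) = btw (lookup (Var C) i)

  map-lookup-zipWith₃ : ∀ {k} (g : Bool → Bool → Bool → Bool) (x y z : Vec Bool m) (is : Vec (Fin m) k) →
    Vec.map (lookup (zipWith₃ g x y z)) is ≡ zipWith₃ g (Vec.map (lookup x) is) (Vec.map (lookup y) is) (Vec.map (lookup z) is)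
  map-lookup-zipWith₃ g x y z []       = refl
  map-lookup-zipWith₃ g x y z (i ∷ is) = cong₂ _∷_ (lookup-zipWith₃ g x y z i) (map-lookup-zipWith₃ g x y z is)

  restrict-zipWith₃ : ∀ (C : Constraint S m) (g : Bool → Bool → Bool → Bool) x y z →
                      restrict C (zipWith₃ g x y z) ≡ zipWith₃ g (restrict C x) (restrict C y) (restrict C z)
  restrict-zipWith₃ C g x y z = map-lookup-zipWith₃ g x y z (Var C)

  argValues-zipWith₃ : ∀ (C : Constraint S m) {g} → (∀ p → g p p p ≡ p) → ∀ x y z →
    argValues C (zipWith₃ g x y z) ≡ zipWith₃ g (argValues C x) (argValues C y) (argValues C z)
  argValues-zipWith₃ C {g} g-idem x y z = go (args C)
    where
    go : ∀ {k} (ts : Vec (Term m) k) → Vec.map (evalT (zipWith₃ g x y z)) ts ≡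
           zipWith₃ g (Vec.map (evalT x) ts) (Vec.map (evalT y) ts) (Vec.map (evalT z) ts)
    go []             = refl
    go (var j ∷ ts)   = cong₂ _∷_ (lookup-zipWith₃ g x y z j) (go ts)
    go (const b ∷ ts) = cong₂ _∷_ (sym (g-idem b)) (go ts)

  SatC-closed : ∀ (C : Constraint S m) {g} → (∀ p → g p p p ≡ p) →
                ClosedUnder g ⟦ relOf S (rel C) ⟧ → ClosedUnder g (SatC C)
  SatC-closed C g-idem R-closed {x} {y} {z} sx sy sz =
    subst ⟦ relOf S (rel C) ⟧ (sym (argValues-zipWith₃ C g-idem x y z)) (R-closed sx sy sz)

  Proj-closed : ∀ {φ : Formula S m} {g} → (∀ p → g p p p ≡ p) →
                (∀ {C} → C ∈ φ → ClosedUnder g ⟦ relOf S (rel C) ⟧) → ∀ C → ClosedUnder g (Proj φ C)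
  Proj-closed {g = g} g-idem closed C (x , sx , refl) (y , sy , refl) (z , sz , refl) =
    zipWith₃ g x y z ,
    All.tabulate (λ {C′} C′∈φ → SatC-closed C′ g-idem (closed C′∈φ)
                                  (All.lookup sx C′∈φ) (All.lookup sy C′∈φ) (All.lookup sz C′∈φ)) ,
    restrict-zipWith₃ C g x y z

  SatC? : ∀ (C : Constraint S m) → Decidable (SatC C)
  SatC? C x = relOf S (rel C) (argValues C x) ≟ᵇ true

  Sat? : ∀ (φ : Formula S m) → Decidable (Sat φ)
  Sat? φ x = All.all? (λ C → SatC? C x) φ

  Proj? : ∀ (φ : Formula S m) C → Decidable (Proj φ C)
  Proj? φ C b = ∃? (λ x → Sat? φ x ×-dec (restrict C x ≟ᵛ b))

  violated : ∀ {φ : Formula S m} {x} → ¬ Sat φ x → ∃[ C ] C ∈ φ × ¬ SatC C x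
  violated {φ} {x} ¬sx = find (¬All⇒Any¬ (λ C → SatC? C x) φ ¬sx)

between? : ∀ {n} (a w c : Vec Bool n) → Dec (Between a w c)
between? a w c = FinP.all? (λ i → (lookup w i ≟ᵇ lookup a i) ⊎-dec (lookup w i ≟ᵇ lookup c i))

xor₃-cancel : ∀ w {a y} → a ≡ y → xor₃ w a y ≡ w
xor₃-cancel w {a} refl = trans (cong (w xor_) (xor-same a)) (xor-identityʳ w)

xor₃-flip : ∀ {w a} y → w ≡ a → xor₃ w a y ≡ y
xor₃-flip {w} y refl = trans (sym (xor-assoc w w y)) (cong (_xor y) (xor-same w))

xor₃-xor₃ : ∀ {n} (w a y : Vec Bool n) → zipWith₃ xor₃ (zipWith₃ xor₃ w a y) a y ≡ w
xor₃-xor₃ w a y = lookup-extensionality λ i →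
  trans (lookup-zipWith₃ xor₃ (zipWith₃ xor₃ w a y) a y i) (trans (cong (λ v → xor₃ v (lookup a i) (lookup y i)) (lookup-zipWith₃ xor₃ w a y i))
        (undo (lookup w i) (lookup a i xor lookup y i)))
  where
  undo : ∀ v k → (v xor k) xor k ≡ v
  undo v k = trans (xor-assoc v k k) (trans (cong (v xor_) (xor-same k)) (xor-identityʳ v))

-- Moving the left end from a to a neighbour y either keeps w between the ends, or w has to be
-- reflected in the coordinate where a and y differ.
between-shift : ∀ {n} {a y w c : Vec Bool n} → Adjacent a y → Between a w c → ¬ Between y w c →
                Between y (zipWith₃ xor₃ w a y) c
between-shift {a = a} {y} {w} {c} adj btw ¬btw i
  rewrite lookup-zipWith₃ xor₃ w a y i with lookup a i ≟ᵇ lookup y i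
... | yes a≡y = Sum.map (λ w≡a → trans (xor₃-cancel _ a≡y) (trans w≡a a≡y)) (trans (xor₃-cancel _ a≡y)) (btw i)
... | no a≢y with k , ¬yc ← FinP.¬∀⟶∃¬ _ _ (λ k → (lookup w k ≟ᵇ lookup y k) ⊎-dec (lookup w k ≟ᵇ lookup c k)) ¬btw
                | btw k
... | inj₂ w≡c = ⊥-elim (¬yc (inj₂ w≡c))
... | inj₁ w≡a with refl ← hamming≤1⇒AtMostOneDifference {x = a} {y} (ℕ.≤-reflexive adj) a≢y
                             (λ a≡y → ¬yc (inj₁ (trans w≡a a≡y)))
  = inj₁ (xor₃-flip (lookup y k) w≡a)

xor₃-closed-convex : ∀ {n} {A : Vec Bool n → Set} → ClosedUnder xor₃ A →
                     ∀ {a c} → A a → Path A a c → ∀ {w} → Between a w c → A w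
xor₃-closed-convex {A = A} closed aa done btw = subst A (sym (between-self btw)) aa
xor₃-closed-convex {A = A} closed {a} {c} aa (step {y = y} adj ay p) {w} btw with between? y w c
... | yes btw′ = xor₃-closed-convex closed ay p btw′
... | no ¬btw  = subst A (xor₃-xor₃ w a y)
                   (closed (xor₃-closed-convex closed ay p (between-shift {a = a} {y} {w} {c} adj btw ¬btw)) aa ay)

-- Identification of variables

Unique⇒lookup-injective : ∀ {A : Set} {xs : List A} → Unique xs →
                          ∀ {p q} → List.lookup xs p ≡ List.lookup xs q → p ≡ q
Unique⇒lookup-injective (_  AllPairs.∷ _) {zero}  {zero}  _  = refl
Unique⇒lookup-injective (x∉ AllPairs.∷ _) {zero}  {suc q} eq = ⊥-elim (All.lookup x∉ (∈-lookup q) eq)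
Unique⇒lookup-injective (x∉ AllPairs.∷ _) {suc p} {zero}  eq = ⊥-elim (All.lookup x∉ (∈-lookup p) (sym eq))
Unique⇒lookup-injective (_  AllPairs.∷ u) {suc p} {suc q} eq = cong suc (Unique⇒lookup-injective u eq)

record ImageFactorisation {A : Set} {k} (f : Fin k → A) : Set where
  field
    size       : ℕ
    onto       : Fin k → Fin size
    into       : Fin size → A
    surjective : Surjective onto
    injective  : ∀ {p q} → into p ≡ into q → p ≡ q
    factorises : ∀ i → into (onto i) ≡ f i

image-factorisation : ∀ {A : Set} {k} → DecidableEquality A → (f : Fin k → A) → ImageFactorisation f
image-factorisation {k = k} _≟_ f = record
  { size       = List.length image
  ; onto       = λ i → Any.index (f∈image i)
  ; into       = List.lookup image
  ; surjective = surjective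
  ; injective  = injective
  ; factorises = λ i → sym (AnyP.lookup-index (f∈image i))
  }
  where
  image = List.deduplicate _≟_ (List.map f (List.allFin k))
  f∈image : ∀ i → f i ∈ image
  f∈image i = ∈-deduplicate⁺ _≟_ (∈-map⁺ f (∈-allFin i))
  injective : ∀ {p q} → List.lookup image p ≡ List.lookup image q → p ≡ q
  injective = Unique⇒lookup-injective (deduplicate-! _≟_ (List.map f (List.allFin k)))
  surjective : Surjective (λ i → Any.index (f∈image i))
  surjective p with i , _ , eq ← ∈-map⁻ f (∈-deduplicate⁻ _≟_ _ (∈-lookup {xs = image} p)) =
    i , injective (trans (sym (AnyP.lookup-index (f∈image i))) (sym eq))

select : ∀ {A : Set} {n k} → (Fin k → Fin n) → Vec A n → Vec A k
select e x = tabulate (lookup x ∘ e)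

select-zipWith₃ : ∀ {n k} (g : Bool → Bool → Bool → Bool) (e : Fin k → Fin n) (a b c : Vec Bool n) →
                  select e (zipWith₃ g a b c) ≡ zipWith₃ g (select e a) (select e b) (select e c)
select-zipWith₃ g e a b c = lookup-extensionality λ p → begin
  lookup (select e (zipWith₃ g a b c)) p
    ≡⟨ VecP.lookup∘tabulate _ p ⟩
  lookup (zipWith₃ g a b c) (e p)
    ≡⟨ lookup-zipWith₃ g a b c (e p) ⟩
  g (lookup a (e p)) (lookup b (e p)) (lookup c (e p))
    ≡⟨ cong₃ g (VecP.lookup∘tabulate _ p) (VecP.lookup∘tabulate _ p) (VecP.lookup∘tabulate _ p) ⟨
  g (lookup (select e a) p) (lookup (select e b) p) (lookup (select e c) p)
    ≡⟨ lookup-zipWith₃ g (select e a) (select e b) (select e c) p ⟨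
  lookup (zipWith₃ g (select e a) (select e b) (select e c)) p ∎
  where open ≡-Reasoning

select-hamming≤1 : ∀ {n k} {e : Fin k → Fin n} → (∀ {p q} → e p ≡ e q → p ≡ q) →
                   ∀ {x y} → hamming x y ≤ 1 → hamming (select e x) (select e y) ≤ 1
select-hamming≤1 {e = e} e-injective {x} {y} h =
  AtMostOneDifference⇒hamming≤1 {x = select e x} {select e y} λ {p} {q} dp dq →
    e-injective (hamming≤1⇒AtMostOneDifference {x = x} {y} h (dp ∘ at p) (dq ∘ at q))
  where
  at : ∀ p → lookup x (e p) ≡ lookup y (e p) → lookup (select e x) p ≡ lookup (select e y) p
  at p eq = trans (VecP.lookup∘tabulate _ p) (trans eq (sym (VecP.lookup∘tabulate _ p)))

hamming-++ʳ : ∀ {n k} (a b : Vec Bool n) (K : Vec Bool k) → hamming (a ++ K) (b ++ K) ≡ hamming a b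
hamming-++ʳ []      []      K = hamming-refl K
hamming-++ʳ (x ∷ a) (y ∷ b) K = cong (bitDistance x y +_) (hamming-++ʳ a b K)

zipWith₃-++ʳ : ∀ {n k} {g : Bool → Bool → Bool → Bool} → (∀ p → g p p p ≡ p) →
               (a b c : Vec Bool n) (K : Vec Bool k) → zipWith₃ g (a ++ K) (b ++ K) (c ++ K) ≡ zipWith₃ g a b c ++ K
zipWith₃-++ʳ {g = g} g-idem []      []      []      K = diagonal K
  where
  diagonal : ∀ {k} (K : Vec Bool k) → zipWith₃ g K K K ≡ K
  diagonal []      = refl
  diagonal (p ∷ K) = cong₂ _∷_ (g-idem p) (diagonal K)
zipWith₃-++ʳ g-idem (x ∷ a) (y ∷ b) (z ∷ c) K = cong (_ ∷_) (zipWith₃-++ʳ g-idem a b c K)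

-- R′ is the relation of C with the positions carrying the same variable identified; positions
-- carrying constants stay separate coordinates.  `lift` sends an assignment to Var(C) to the
-- corresponding tuple of R′.
module Identification {S : Language} {m : ℕ} (C : Constraint S m) where

  k  = arity S (rel C)
  nv = List.length (varList C)
  R  = relOf S (rel C)

  constantValue : Term m → Bool
  constantValue (var _)   = false
  constantValue (const b) = b

  constants : Vec Bool k
  constants = Vec.map constantValue (args C)

  slotOf : ∀ i t → lookup (args C) i ≡ t → Fin (nv + k)
  slotOf i (var j)   eq = Any.index (arg∈varList C eq) ↑ˡ k
  slotOf i (const _) _  = nv ↑ʳ i

  slot : Fin k → Fin (nv + k)
  slot i = slotOf i _ refl

  lookup-slot : ∀ x i → lookup (restrict C x ++ constants) (slot i) ≡ evalT x (lookup (args C) i)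
  lookup-slot x i = go _ refl
    where
    go : ∀ t (eq : lookup (args C) i ≡ t) → lookup (restrict C x ++ constants) (slotOf i t eq) ≡ evalT x t
    go (var j)   eq = trans (VecP.lookup-++ˡ (restrict C x) constants _) (lookup-restrict C x (arg∈varList C eq))
    go (const b) eq = trans (VecP.lookup-++ʳ (restrict C x) constants i)
                        (trans (VecP.lookup-map i constantValue (args C)) (cong constantValue eq))

  open ImageFactorisation (image-factorisation _≟ᶠ_ slot) public

  lift : Vec Bool nv → Vec Bool size
  lift b = select into (b ++ constants)

  R′ : Rel size
  R′ = identify onto R

  R′-lift : ∀ x → R′ (lift (restrict C x)) ≡ R (argValues C x)
  R′-lift x = cong R (lookup-extensionality λ i → begin
    lookup (tabulate (λ i → lookup (lift (restrict C x)) (onto i))) i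
      ≡⟨ VecP.lookup∘tabulate _ i ⟩
    lookup (lift (restrict C x)) (onto i)
      ≡⟨ VecP.lookup∘tabulate _ (onto i) ⟩
    lookup (restrict C x ++ constants) (into (onto i))
      ≡⟨ cong (lookup (restrict C x ++ constants)) (factorises i) ⟩
    lookup (restrict C x ++ constants) (slot i)
      ≡⟨ lookup-slot x i ⟩
    evalT x (lookup (args C) i)
      ≡⟨ VecP.lookup-map i (evalT x) (args C) ⟨
    lookup (argValues C x) i ∎)
    where open ≡-Reasoning

  SatC⇒R′ : ∀ {x} → SatC C x → ⟦ R′ ⟧ (lift (restrict C x))
  SatC⇒R′ {x} = subst (_≡ true) (sym (R′-lift x))

  R′⇒SatC : ∀ {x} → ⟦ R′ ⟧ (lift (restrict C x)) → SatC C x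
  R′⇒SatC {x} = subst (_≡ true) (R′-lift x)

  lift-nonExpanding : NonExpanding lift
  lift-nonExpanding {a} {b} adj =
    select-hamming≤1 injective {a ++ constants} {b ++ constants} (ℕ.≤-reflexive (trans (hamming-++ʳ a b constants) adj))

  lift-zipWith₃ : ∀ {g} → (∀ p → g p p p ≡ p) → ∀ a b c →
                  lift (zipWith₃ g a b c) ≡ zipWith₃ g (lift a) (lift b) (lift c)
  lift-zipWith₃ {g} g-idem a b c =
    trans (cong (select into) (sym (zipWith₃-++ʳ g-idem a b c constants)))
          (select-zipWith₃ g into (a ++ constants) (b ++ constants) (c ++ constants))

component-closed :
  ∀ {Prop : ∀ {n} → (Vec Bool n → Set) → Set} {g} → (∀ p → g p p p ≡ p) →
  (∀ {n} {P : Vec Bool n → Set} → Prop P → ClosedUnder g P) →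
  ∀ {S m} {φ : Formula S m} {C} → C ∈ φ → SafelyComponentwise Prop (relOf S (rel C)) →
  ∀ {o x y z} → SatC C o →
  Path (Proj φ C) (restrict C o) (restrict C x) → Path (Proj φ C) (restrict C o) (restrict C y) →
  Path (Proj φ C) (restrict C o) (restrict C z) → SatC C (zipWith₃ g x y z)
component-closed {Prop = Prop} {g} g-idem Prop⇒closed {φ = φ} {C} C∈φ (_ , identified) {o} {x} {y} {z}
                 so o⇝x o⇝y o⇝z =
  R′⇒SatC (subst ⟦ R′ ⟧ (sym lift-restrict)
             (proj₁ (Prop⇒closed component (in-component {x} o⇝x) (in-component {y} o⇝y) (in-component {z} o⇝z))))
  where
  open Identification C
  start = lift (restrict C o)
  component : Prop (Component ⟦ R′ ⟧ start)
  component = identified size onto surjective start (SatC⇒R′ so)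
  Proj⇒R′ : ∀ {b} → Proj φ C b → ⟦ R′ ⟧ (lift b)
  Proj⇒R′ (w , sw , refl) = SatC⇒R′ (All.lookup sw C∈φ)
  in-component : ∀ {w} → Path (Proj φ C) (restrict C o) (restrict C w) →
                 Component ⟦ R′ ⟧ start (lift (restrict C w))
  in-component o⇝w = Path-target (SatC⇒R′ so) lifted , lifted
    where lifted = Path-map lift (λ {a b} → lift-nonExpanding {a} {b}) Proj⇒R′ o⇝w
  lift-restrict : lift (restrict C (zipWith₃ g x y z)) ≡
                  zipWith₃ g (lift (restrict C x)) (lift (restrict C y)) (lift (restrict C z))
  lift-restrict = trans (cong lift (restrict-zipWith₃ C g x y z)) (lift-zipWith₃ g-idem (restrict C x) (restrict C y) (restrict C z))

record IntervalOperation : Set where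
  field
    op     : Bool → Bool → Bool → Bool
    op-xxy : ∀ p r → op p p r ≡ p
    op-xyx : ∀ p q → op p q p ≡ p
    op-xyy : ∀ p q → op p q q ≡ p → op q p p ≡ p

  op-idem : ∀ p → op p p p ≡ p
  op-idem p = op-xxy p p

  zipWith₃-xyx : ∀ {n} (a c : Vec Bool n) → zipWith₃ op a c a ≡ a
  zipWith₃-xyx a c = lookup-extensionality λ i → trans (lookup-zipWith₃ op a c a i) (op-xyx _ _)

  zipWith₃-xyy : ∀ {n} (a c : Vec Bool n) → zipWith₃ op a c c ≡ a → zipWith₃ op c a a ≡ a
  zipWith₃-xyy a c eq = lookup-extensionality λ i →
    trans (lookup-zipWith₃ op c a a i)
          (op-xyy _ _ (trans (sym (lookup-zipWith₃ op a c c i)) (cong (λ v → lookup v i) eq)))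

  zipWith₃-nonExpanding : ∀ {n} (a c : Vec Bool n) → NonExpanding (zipWith₃ op a c)
  zipWith₃-nonExpanding a c {x} {y} adj = ℕ.≤-trans (hamming-zipWith₃-≤ op a c x y) (ℕ.≤-reflexive adj)

  -- Whichever of op(a,c,c) ∈ {a, c} holds, one of op(a,c,·) and op(c,a,·) fixes both a and c.
  interval-Path⇒hamming≤1 :
    ∀ {n} {Q : Vec Bool n → Set} {a c} →
    (∀ {b} → Q b → (zipWith₃ op a c b ≡ a ⊎ zipWith₃ op a c b ≡ c) ×
                   (zipWith₃ op c a b ≡ a ⊎ zipWith₃ op c a b ≡ c)) →
    Q c → Path Q a c → hamming a c ≤ 1
  interval-Path⇒hamming≤1 {a = a} {c} endpoints qc a⇝c with proj₁ (endpoints qc)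
  ... | inj₂ acc≡c = two-valued-Path⇒hamming≤1 (zipWith₃ op a c) (zipWith₃-nonExpanding a c)
                       (proj₁ ∘ endpoints) (zipWith₃-xyx a c) acc≡c a⇝c
  ... | inj₁ acc≡a = two-valued-Path⇒hamming≤1 (zipWith₃ op c a) (zipWith₃-nonExpanding c a)
                       (proj₂ ∘ endpoints) (zipWith₃-xyy a c acc≡a) (zipWith₃-xyx c a) a⇝c

majority-operation : IntervalOperation
majority-operation = record
  { op     = majority
  ; op-xxy = λ _ _ → majority-xxy refl refl
  ; op-xyx = λ _ _ → majority-xyx refl refl
  ; op-xyy = xyy
  }
  where
  xyy : ∀ p q → majority p q q ≡ p → majority q p p ≡ p
  xyy true  true  _ = refl
  xyy false false _ = refl

ihsb-operation : Bool → IntervalOperation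
ihsb-operation s = record { op = ihsb s ; op-xxy = xxy s ; op-xyx = xyx s ; op-xyy = xyy s }
  where
  xxy : ∀ s p r → ihsb s p p r ≡ p
  xxy true  true  _ = refl
  xxy true  false _ = refl
  xxy false true  _ = refl
  xxy false false _ = refl
  xyx : ∀ s p q → ihsb s p q p ≡ p
  xyx true  true  true  = refl
  xyx true  true  false = refl
  xyx true  false _     = refl
  xyx false true  _     = refl
  xyx false false true  = refl
  xyx false false false = refl
  xyy : ∀ s p q → ihsb s p q q ≡ p → ihsb s q p p ≡ p
  xyy true  true  true  _ = refl
  xyy true  false true  _ = refl
  xyy true  false false _ = refl
  xyy false true  true  _ = refl
  xyy false true  false _ = refl
  xyy false false false _ = refl

hamming≤1-between : ∀ {n} {a w c : Vec Bool n} → hamming a c ≤ 1 → Between a w c → w ≡ a ⊎ w ≡ c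
hamming≤1-between {a = a} {w} {c} h btw with hamming a w in d | between-hamming {a = a} {w} {c} btw
... | zero  | _   = inj₁ (sym (hamming≡0⇒≡ d))
... | suc k | sum = inj₂ (hamming≡0⇒≡ (ℕ.n≤0⇒n≡0
                      (ℕ.≤-trans (ℕ.m≤n+m _ k) (ℕ.≤-pred (subst (_≤ 1) (sym sum) h)))))

strictly-between-closer : ∀ {n} {a w c : Vec Bool n} → StrictlyBetween a w c →
                          hamming a w < hamming a c × hamming w c < hamming a c
strictly-between-closer {a = a} {w} {c} (btw , w≢a , w≢c) =
  subst (_ <_) sum (ℕ.m<m+n _ (≢⇒hamming-pos w≢c)) , subst (_ <_) sum (ℕ.m<n+m _ (≢⇒hamming-pos (w≢a ∘ sym)))
  where sum = between-hamming {a = a} {w} {c} btw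

hamming≤1⇒Path : ∀ {n} {P : Vec Bool n → Set} {x y} → P y → hamming x y ≤ 1 → Path P x y
hamming≤1⇒Path {P = P} {x} {y} py h with hamming x y in d
... | zero        = subst (Path P x) (hamming≡0⇒≡ d) done
... | suc zero    = step d py done
... | suc (suc _) with s≤s () ← h

module Separation {S : Language} {m : ℕ} (φ : Formula S m) where

  Separated : Set
  Separated = Any (λ C → Disconnected (Proj φ C)) φ

  Split : Vec Bool m → Vec Bool m → Set
  Split u v = (∃[ w ] Sat φ w × StrictlyBetween u w v) ⊎ Separated

  SplitOrSeparate : Set
  SplitOrSeparate = ∀ {u v} → Sat φ u → Sat φ v → 2 ≤ hamming u v → Split u v

  connect-or-separate : SplitOrSeparate → ∀ {u v} → Sat φ u → Sat φ v → Path (Sat φ) u v ⊎ Separated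
  connect-or-separate split = go (<-wellFounded _)
    where
    go : ∀ {u v} → Acc _<_ (hamming u v) → Sat φ u → Sat φ v → Path (Sat φ) u v ⊎ Separated
    go {u} {v} (acc rec) su sv with 2 ℕ.≤? hamming u v
    ... | no  d≱2 = inj₁ (hamming≤1⇒Path sv (ℕ.≤-pred (ℕ.≰⇒> d≱2)))
    ... | yes d≥2 with split su sv d≥2
    ...   | inj₂ sep = inj₂ sep
    ...   | inj₁ (w , sw , sb) with go (rec (proj₁ (strictly-between-closer sb))) su sw
                                    | go (rec (proj₂ (strictly-between-closer sb))) sw sv
    ...     | inj₁ u⇝w | inj₁ w⇝v = inj₁ (Path-++ u⇝w w⇝v)
    ...     | inj₂ sep | _        = inj₂ sep
    ...     | inj₁ _   | inj₂ sep = inj₂ sep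

  separated : ∀ {C} → C ∈ φ → ∀ {a c} → Sat φ a → Sat φ c → ¬ Path (Proj φ C) (restrict C a) (restrict C c) → Separated
  separated {C} C∈φ sa sc ¬path = lose C∈φ (_ , _ , Proj-restrict C sa , Proj-restrict C sc , ¬path)

  Forced : (u v z w : Vec Bool m) → Set
  Forced u v z w = ∀ {C} → C ∈ φ → Path (Proj φ C) (restrict C u) (restrict C v) →
                   Path (Proj φ C) (restrict C u) (restrict C z) → SatC C w

  forced-split : ∀ {u v z w} → Sat φ u → Sat φ v → Sat φ z → StrictlyBetween u w v → Forced u v z w → Split u v
  forced-split {u} {v} {z} {w} su sv sz sb forced with Sat? φ w
  ... | yes sw = inj₁ (w , sw , sb)
  ... | no ¬sw with C , C∈φ , ¬sCw ← violated ¬sw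
                  with Path? (Proj? φ C) (restrict C u) (restrict C v) | Path? (Proj? φ C) (restrict C u) (restrict C z)
  ...   | no ¬u⇝v | _        = inj₂ (separated C∈φ su sv ¬u⇝v)
  ...   | yes _   | no ¬u⇝z  = inj₂ (separated C∈φ su sz ¬u⇝z)
  ...   | yes u⇝v | yes u⇝z  = ⊥-elim (¬sCw (forced C∈φ u⇝v u⇝z))

  affine-split : (∀ {C} → C ∈ φ → ClosedUnder xor₃ ⟦ relOf S (rel C) ⟧) → SplitOrSeparate
  affine-split closed {u} {v} su sv d≥2 with w , sb@(btw , _) ← interior-point d≥2 =
    forced-split su sv sv sb λ {C} C∈φ u⇝v _ →
      Proj⇒SatC C∈φ (xor₃-closed-convex (Proj-closed xor₃-idem closed C) (Proj-restrict C su) u⇝v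
                                        (restrict-between C {u} {w} {v} btw))

  module _ (o : IntervalOperation) {Prop : ∀ {n} → (Vec Bool n → Set) → Set}
           (Prop⇒closed : ∀ {n} {P : Vec Bool n → Set} → Prop P → ClosedUnder (IntervalOperation.op o) P)
           (safe : ∀ {C} → C ∈ φ → SafelyComponentwise Prop (relOf S (rel C))) where

    open IntervalOperation o

    Mixed : Vec Bool m → Vec Bool m → Vec Bool m → Set
    Mixed u v w = w ≢ u × w ≢ v

    mixed? : ∀ u v w → Dec (Mixed u v w)
    mixed? u v w = ¬? (w ≟ᵛ u) ×-dec ¬? (w ≟ᵛ v)

    ¬mixed⇒endpoint : ∀ {u v w} → ¬ Mixed u v w → w ≡ u ⊎ w ≡ v
    ¬mixed⇒endpoint {u} {v} {w} ¬mixed with w ≟ᵛ u | w ≟ᵛ v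
    ... | yes w≡u | _       = inj₁ w≡u
    ... | no  _   | yes w≡v = inj₂ w≡v
    ... | no  w≢u | no  w≢v = ⊥-elim (¬mixed (w≢u , w≢v))

    interval-split : SplitOrSeparate
    interval-split {u} {v} su sv d≥2
      with ∃? (λ z → Sat? φ z ×-dec (mixed? u v (zipWith₃ op u v z) ⊎-dec mixed? u v (zipWith₃ op v u z)))
    ... | yes (z , sz , inj₁ mixed) =
      forced-split su sv sz (zipWith₃-between op op-xxy u v z , mixed) λ C∈φ u⇝v u⇝z →
        component-closed op-idem Prop⇒closed C∈φ (safe C∈φ) (All.lookup su C∈φ) done u⇝v u⇝z
    ... | yes (z , sz , inj₂ mixed) =
      forced-split su sv sz (between-sym {a = v} {zipWith₃ op v u z} {u} (zipWith₃-between op op-xxy v u z) , mixed) λ C∈φ u⇝v u⇝z →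
        component-closed op-idem Prop⇒closed C∈φ (safe C∈φ) (All.lookup su C∈φ) u⇝v done u⇝z
    ... | no none with w , sb@(btw , _) ← interior-point d≥2 =
      forced-split su sv sv sb λ {C} C∈φ u⇝v _ →
        [ (λ w≡u → SatC-restrict C (sym w≡u) (All.lookup su C∈φ))
        , (λ w≡v → SatC-restrict C (sym w≡v) (All.lookup sv C∈φ)) ]′
          (hamming≤1-between (interval-Path⇒hamming≤1 (endpoints C) (Proj-restrict C sv) u⇝v)
                             (restrict-between C {u} {w} {v} btw))
      where
      endpoint : ∀ {z} → Sat φ z → (zipWith₃ op u v z ≡ u ⊎ zipWith₃ op u v z ≡ v) ×
                                     (zipWith₃ op v u z ≡ u ⊎ zipWith₃ op v u z ≡ v)
      endpoint {z} sz = ¬mixed⇒endpoint (λ mixed → none (z , sz , inj₁ mixed)) ,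
                        ¬mixed⇒endpoint (λ mixed → none (z , sz , inj₂ mixed))
      endpoints : ∀ C {b} → Proj φ C b →
        (zipWith₃ op (restrict C u) (restrict C v) b ≡ restrict C u ⊎ zipWith₃ op (restrict C u) (restrict C v) b ≡ restrict C v) ×
        (zipWith₃ op (restrict C v) (restrict C u) b ≡ restrict C u ⊎ zipWith₃ op (restrict C v) (restrict C u) b ≡ restrict C v)
      endpoints C (z , sz , refl) = Sum.map restricted restricted (proj₁ (endpoint sz)) ,
                                    Sum.map restricted restricted (proj₂ (endpoint sz))
        where
        restricted : ∀ {x y w} → zipWith₃ op x y z ≡ w → zipWith₃ op (restrict C x) (restrict C y) (restrict C z) ≡ restrict C w
        restricted {x} {y} eq = trans (sym (restrict-zipWith₃ C op x y z)) (cong (restrict C) eq)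

lemma2p32 : (S : Language) →
    ( All (λ p → SafelyComponentwise Bijunctive (proj₂ p)) S
    ⊎ All (λ p → SafelyComponentwise IHSBminus (proj₂ p)) S
    ⊎ All (λ p → SafelyComponentwise IHSBplus (proj₂ p)) S
    ⊎ All (λ p → Affine ⟦ proj₂ p ⟧) S ) →
    ConstraintProjectionSeparating S
lemma2p32 S classes m φ (u , v , su , sv , ¬u⇝v) =
  [ (λ u⇝v → ⊥-elim (¬u⇝v u⇝v)) , id ]′ (connect-or-separate (split-or-separate classes) su sv)
  where
  open Separation φ
  for-constraint : ∀ {Q : ∀ {n} → Rel n → Set} → All (λ p → Q (proj₂ p)) S →
                   ∀ {C} → C ∈ φ → Q (relOf S (rel C))
  for-constraint all {C} _ = All.lookup all (∈-lookup (rel C))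
  split-or-separate : _ → SplitOrSeparate
  split-or-separate (inj₁ bij) =
    interval-split majority-operation (CNF-closed majority-2-clause) (for-constraint bij)
  split-or-separate (inj₂ (inj₁ minus)) =
    interval-split (ihsb-operation true) (CNF-closed (ihsb-clause true)) (for-constraint minus)
  split-or-separate (inj₂ (inj₂ (inj₁ plus))) =
    interval-split (ihsb-operation false) (CNF-closed (ihsb-clause false)) (for-constraint plus)
  split-or-separate (inj₂ (inj₂ (inj₂ aff))) =
    affine-split (λ C∈φ → affine-closed (for-constraint aff C∈φ))
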